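{- Let $f(r)$ denote the minimum number of edges of an $r$-partite intersecting hypergraph $\mathcal{H}$ with $\tau(\mathcal{H}) \ge r-1$. Then $f(4)=6$, $f(5)=9$, and $12 \le f(6) \le 15$.
   Context: A hypergraph is $r$-partite if its vertex set can be partitioned into $r$ parts such that every edge contains exactly one vertex from each part. A hypergraph is intersecting if every two edges have nonempty intersection. The cover number $\tau(\mathcal{H})$ is the minimum size of a set of vertices meeting every edge of $\mathcal{H}$. -}

module Defs where

open import Data.Nat using (ℕ; _≤_; _∸_)
open import Data.Fin using (Fin)
open import Data.Vec using (Vec; lookup)
open import Data.List using (List; length)
open import Data.List.Membership.Propositional using (_∈_)
open import Data.List.Relation.Unary.Any using (Any)
open import Data.List.Relation.Unary.Unique.Propositional using (Unique)
open import Data.Product using (Σ; _×_; ∃-syntax)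
open import Relation.Binary.PropositionalEquality using (_≡_)

-- An r-partite hypergraph: the vertex set is partitioned into r parts
-- (part i has vertices labelled by ℕ, i.e. vertex = (i , v)).
-- An edge contains exactly one vertex from each part, so it is a
-- vector e : Vec ℕ r, where lookup e i is its vertex in part i.
Vertex : ℕ → Set
Vertex r = Fin r × ℕ

Edge : ℕ → Set
Edge r = Vec ℕ r

-- A (finite) hypergraph is its list of edges; Simple says the edges
-- are distinct, so the number of edges is the length of the list.
Hypergraph : ℕ → Set
Hypergraph r = List (Edge r)

Simple : ∀ {r} → Hypergraph r → Set
Simple H = Unique H

_∈ₑ_ : ∀ {r} → Vertex r → Edge r → Set
(i Data.Product., v) ∈ₑ e = lookup e i ≡ v

Intersecting : ∀ {r} → Hypergraph r → Set
Intersecting {r} H = ∀ {e e′} → e ∈ H → e′ ∈ H → ∃[ i ] (lookup e i ≡ lookup e′ i)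

IsCover : ∀ {r} → List (Vertex r) → Hypergraph r → Set
IsCover C H = ∀ {e} → e ∈ H → Any (λ x → x ∈ₑ e) C

CoverNumberAtLeast : ∀ {r} → ℕ → Hypergraph r → Set
CoverNumberAtLeast k H = ∀ C → IsCover C H → k ≤ length C

Admissible : (r : ℕ) → Hypergraph r → Set
Admissible r H = Simple H × Intersecting H × CoverNumberAtLeast (r ∸ 1) H

IsF : ℕ → ℕ → Set
IsF r m = (Σ (Hypergraph r) λ H → Admissible r H × length H ≡ m)
        × (∀ H → Admissible r H → m ≤ length H)

FAtMost : ℕ → ℕ → Set
FAtMost r m = Σ (Hypergraph r) λ H → Admissible r H × length H ≤ m

FAtLeast : ℕ → ℕ → Set
FAtLeast r m = ∀ H → Admissible r H → m ≤ length H

{-# OPTIONS --safe #-}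

-- Lower bounds: C(n,2) pairs of edges agree in r parts, so some part i sees at
-- least C(n,2)/r agreeing pairs; then many edges share vertices of part i, and
-- taking vertices of degree ≥ 3 in this single part, followed by one vertex for
-- every two remaining edges, gives a cover of size r − 2.
--
-- Upper bounds: a truncated projective plane of order r − 1 consists of the
-- lines y = m x + b of the affine plane over GF(r − 1), and a suitable subset of
-- these lines already has cover number r − 1.
module Submission where

open import Defs
open import Data.Fin using (Fin; zero; suc)
open import Data.Fin.Properties using (any?)
open import Data.List using ([]; _∷_; length; filter; removeAt)
open import Data.List.Membership.Propositional using (_∈_)
open import Data.List.Membership.Propositional.Properties using (∈-filter⁺; ∈-filter⁻)
open import Data.List.Properties using (filter-accept; filter-reject; length-removeAt)
open import Data.List.Relation.Binary.Sublist.Propositional using (_∷ʳ_; ⊆-refl)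
open import Data.List.Relation.Binary.Sublist.Propositional.Properties
  using (filter-⊆; filter⁺; length-mono-≤)
open import Data.List.Relation.Unary.All as All using ()
open import Data.List.Relation.Unary.Any using (Any; here; there; index)
open import Data.List.Relation.Unary.Any.Properties using (lookup-index)
import Data.List.Relation.Unary.Unique.DecPropositional as DecUnique
open import Data.Nat
open import Data.Nat.Properties
open import Data.Nat.Tactic.RingSolver using (solve-∀)
open import Data.Product using (_×_; _,_; proj₁; ∃-syntax)
open import Data.Sum using (inj₁; inj₂)
open import Data.Unit using (tt)
open import Data.Vec using ([]; _∷_; lookup)
open import Data.Vec.Functional using (Vector)
open import Data.Vec.Properties using (≡-dec)
open import Function using (_∘_)
open import Relation.Binary.PropositionalEquality
open import Relation.Nullary using (¬_; Dec; yes; no; ¬?)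
open import Relation.Nullary.Decidable using (map′; toWitness; toWitnessFalse; True; False)
open import Relation.Nullary.Negation using (contradiction)

open import Algebra.Properties.CommutativeMonoid.Sum +-0-commutativeMonoid
  using (sum; ∑-distrib-+)

private
  variable
    r b d k m n p : ℕ

-- Coverability, vertex degrees and agreeing pairs

Coverable : ℕ → Hypergraph r → Set
Coverable k L = ∃[ C ] length C ≤ k × IsCover C L

AllCoverable : (r k n : ℕ) → Set
AllCoverable r k n = ∀ (L : Hypergraph r) → Intersecting L → length L ≤ n → Coverable k L

contains? : (i : Fin r) (v : ℕ) (e : Edge r) → Dec ((i , v) ∈ₑ e)
contains? i v e = lookup e i ≟ v

misses? : (i : Fin r) (v : ℕ) (e : Edge r) → Dec (¬ (i , v) ∈ₑ e)
misses? i v e = ¬? (contains? i v e)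

through : Fin r → ℕ → Hypergraph r → Hypergraph r
through i v = filter (contains? i v)

avoiding : Fin r → ℕ → Hypergraph r → Hypergraph r
avoiding i v = filter (misses? i v)

degree : Fin r → ℕ → Hypergraph r → ℕ
degree i v L = length (through i v L)

-- Each unordered pair of list positions is counted once, at its earlier edge. Repeated edges count
-- as agreeing pairs too.
agreeingPairs : Fin r → Hypergraph r → ℕ
agreeingPairs i []      = 0
agreeingPairs i (e ∷ L) = degree i (lookup e i) L + agreeingPairs i L

choose2 : ℕ → ℕ
choose2 zero    = 0
choose2 (suc n) = n + choose2 n

module _ (i : Fin r) where

  degree-accept : ∀ {v e} L → lookup e i ≡ v → degree i v (e ∷ L) ≡ suc (degree i v L)
  degree-accept {v} {e} L eq = cong length (filter-accept (contains? i v) {e} {L} eq)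

  degree-reject : ∀ {v e} L → lookup e i ≢ v → degree i v (e ∷ L) ≡ degree i v L
  degree-reject {v} {e} L neq = cong length (filter-reject (contains? i v) {e} {L} neq)

  avoiding-accept : ∀ {v e} L → lookup e i ≢ v → avoiding i v (e ∷ L) ≡ e ∷ avoiding i v L
  avoiding-accept {v} {e} L neq = filter-accept (misses? i v) {e} {L} neq

  avoiding-reject : ∀ {v e} L → lookup e i ≡ v → avoiding i v (e ∷ L) ≡ avoiding i v L
  avoiding-reject {v} {e} L eq = filter-reject (misses? i v) {e} {L} (λ neq → neq eq)

  degree+avoiding : ∀ v L → degree i v L + length (avoiding i v L) ≡ length L
  degree+avoiding v [] = refl
  degree+avoiding v (e ∷ L) with lookup e i ≟ v
  ... | yes eq rewrite degree-accept {v} {e} L eq | avoiding-reject {v} {e} L eq =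
    cong suc (degree+avoiding v L)
  ... | no neq rewrite degree-reject {v} {e} L neq | avoiding-accept {v} {e} L neq =
    trans (+-suc _ _) (cong suc (degree+avoiding v L))

  degree-avoiding : ∀ {v w} → w ≢ v → ∀ L → degree i w (avoiding i v L) ≡ degree i w L
  degree-avoiding w≢v [] = refl
  degree-avoiding {v} {w} w≢v (e ∷ L) with lookup e i ≟ v
  ... | yes eq rewrite avoiding-reject {v} {e} L eq
                     | degree-reject {w} {e} L (λ eq′ → w≢v (trans (sym eq′) eq)) =
    degree-avoiding w≢v L
  ... | no neq rewrite avoiding-accept {v} {e} L neq with lookup e i ≟ w
  ...   | yes eq rewrite degree-accept {w} {e} L eq
                       | degree-accept {w} {e} (avoiding i v L) eq =
    cong suc (degree-avoiding w≢v L)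
  ...   | no neq′ rewrite degree-reject {w} {e} L neq′
                        | degree-reject {w} {e} (avoiding i v L) neq′ =
    degree-avoiding w≢v L

  degree-avoiding-≤ : ∀ v w L → degree i w (avoiding i v L) ≤ degree i w L
  degree-avoiding-≤ v w L =
    length-mono-≤ (filter⁺ (contains? i w) (contains? i w) (λ { refl eq → eq }) (filter-⊆ (misses? i v) L))

  -- Two edges that agree in part `i` either both contain the vertex `(i , v)` or both avoid it, so
  -- no pair is mixed.
  agreeingPairs-split : ∀ v L →
    agreeingPairs i L ≡ choose2 (degree i v L) + agreeingPairs i (avoiding i v L)
  agreeingPairs-split v [] = refl
  agreeingPairs-split v (e ∷ L) with lookup e i ≟ v
  ... | yes refl rewrite degree-accept {v} {e} L refl | avoiding-reject {v} {e} L refl =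
    trans (cong (degree i v L +_) (agreeingPairs-split v L)) (sym (+-assoc (degree i v L) _ _))
  ... | no neq rewrite degree-reject {v} {e} L neq
                     | avoiding-accept {v} {e} L neq
                     | degree-avoiding neq L =
    trans (cong (degree i w L +_) (agreeingPairs-split v L))
      (x+[y+z]≡y+[x+z] (degree i w L) (choose2 (degree i v L)) _)
    where
    w = lookup e i
    x+[y+z]≡y+[x+z] : ∀ x y z → x + (y + z) ≡ y + (x + z)
    x+[y+z]≡y+[x+z] = solve-∀

-- Many agreeing pairs force a vertex of large degree

2*choose2 : ∀ c → 2 * choose2 (suc c) ≡ c * suc c
2*choose2 zero    = refl
2*choose2 (suc c) = trans (*-distribˡ-+ 2 (suc c) (choose2 (suc c)))
  (trans (cong (2 * suc c +_) (2*choose2 c)) (lemma c))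
  where
  lemma : ∀ c → 2 * suc c + c * suc c ≡ suc c * suc (suc c)
  lemma = solve-∀

2*choose2-≤ : ∀ c → c ≤ suc d → 2 * choose2 c ≤ d * c
2*choose2-≤ zero    _         = z≤n
2*choose2-≤ {d} (suc c) (s≤s c≤d) =
  ≤-trans (≤-reflexive (2*choose2 c)) (*-monoˡ-≤ (suc c) c≤d)

-- The c ≤ d + 1 edges through a light vertex contain only c (c − 1) / 2 ≤ d c / 2 agreeing pairs.
heavyVertex : ∀ (i : Fin r) L → d * length L < 2 * agreeingPairs i L →
  ∃[ v ] suc d < degree i v L
heavyVertex {r} {d} i L = go (length L) L ≤-refl
  where
  -- The bound `n` on the length makes the recursion structural, since the recursive call is on a
  -- filtered list.
  go : ∀ n (L : Hypergraph r) → length L ≤ n → d * length L < 2 * agreeingPairs i L →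
    ∃[ v ] suc d < degree i v L
  go _ [] _ lt = contradiction lt λ ()
  go (suc n) L₀@(e ∷ L) (s≤s L≤n) lt with suc d <? degree i (lookup e i) L₀
  ... | yes heavy = _ , heavy
  ... | no light  =
    let w , w-heavy = go n R R≤n rest-lt in
    w , ≤-trans w-heavy (degree-avoiding-≤ i v w L₀)
    where
    v = lookup e i
    c = degree i v L₀
    R = avoiding i v L₀
    R≤n : length R ≤ n
    R≤n rewrite avoiding-reject i {v} {e} L refl =
      ≤-trans (m≤n+m _ (degree i v L)) (≤-trans (≤-reflexive (degree+avoiding i v L)) L≤n)
    rest-lt : d * length R < 2 * agreeingPairs i R
    rest-lt = +-cancelˡ-< (d * c) _ _ (begin-strict
      d * c + d * length R                ≡⟨ *-distribˡ-+ d c (length R) ⟨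
      d * (c + length R)                  ≡⟨ cong (d *_) (degree+avoiding i v L₀) ⟩
      d * length L₀                       <⟨ lt ⟩
      2 * agreeingPairs i L₀              ≡⟨ cong (2 *_) (agreeingPairs-split i v L₀) ⟩
      2 * (choose2 c + agreeingPairs i R) ≡⟨ *-distribˡ-+ 2 (choose2 c) _ ⟩
      2 * choose2 c + 2 * agreeingPairs i R
        ≤⟨ +-monoˡ-≤ _ (2*choose2-≤ c (≮⇒≥ light)) ⟩
      d * c + 2 * agreeingPairs i R       ∎)
      where open ≤-Reasoning

-- Double counting of agreeing pairs over the parts

sum-≤ : ∀ (f : Vector ℕ n) → (∀ i → f i ≤ b) → sum f ≤ n * b
sum-≤ {zero}  f f≤b = z≤n
sum-≤ {suc n} f f≤b = +-mono-≤ (f≤b zero) (sum-≤ (f ∘ suc) (f≤b ∘ suc))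

sum-mono-≤ : ∀ (f g : Vector ℕ n) → (∀ i → f i ≤ g i) → sum f ≤ sum g
sum-mono-≤ {zero}  f g f≤g = z≤n
sum-mono-≤ {suc n} f g f≤g = +-mono-≤ (f≤g zero) (sum-mono-≤ (f ∘ suc) (g ∘ suc) (f≤g ∘ suc))

sum-mono-< : ∀ (f g : Vector ℕ n) → (∀ i → f i ≤ g i) → ∀ j → f j < g j → sum f < sum g
sum-mono-< f g f≤g zero    lt = +-mono-<-≤ lt (sum-mono-≤ (f ∘ suc) (g ∘ suc) (f≤g ∘ suc))
sum-mono-< f g f≤g (suc j) lt =
  +-mono-≤-< (f≤g zero) (sum-mono-< (f ∘ suc) (g ∘ suc) (f≤g ∘ suc) j lt)

-- Every edge of `L` shares a vertex with `e` in some part, so at least one of the degrees counts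
-- it.
length≤∑degree : ∀ (e : Edge r) L → (∀ {e′} → e′ ∈ L → ∃[ i ] (lookup e i ≡ lookup e′ i)) →
  length L ≤ sum (λ i → degree i (lookup e i) L)
length≤∑degree e []       meets = z≤n
length≤∑degree e (e′ ∷ L) meets with j , eq ← meets (here refl) =
  <-≤-trans (s≤s (length≤∑degree e L (meets ∘ there)))
    (sum-mono-< _ (λ i → degree i (lookup e i) (e′ ∷ L))
      (λ i → length-mono-≤ (filter⁺ (through? i) (through? i) (λ { refl eq → eq }) (e′ ∷ʳ ⊆-refl)))
      j (≤-reflexive (sym (degree-accept j {e = e′} L (sym eq)))))
  where through? = λ i → contains? i (lookup e i)

-- Every pair of edges agrees in at least one part; the pairs are grouped by their earlier edge.
choose2≤∑agreeingPairs : ∀ (L : Hypergraph r) → Intersecting L →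
  choose2 (length L) ≤ sum (λ i → agreeingPairs i L)
choose2≤∑agreeingPairs []      int = z≤n
choose2≤∑agreeingPairs (e ∷ L) int = ≤-trans
  (+-mono-≤ (length≤∑degree e L (int (here refl) ∘ there))
            (choose2≤∑agreeingPairs L (λ a b → int (there a) (there b))))
  (≤-reflexive (sym (∑-distrib-+ (λ i → degree i (lookup e i) L) (λ i → agreeingPairs i L))))

-- Pigeonhole: at most `b` agreeing pairs in each of the `r` parts would give at most `r * b` in
-- total.
richPart : ∀ (L : Hypergraph r) → Intersecting L → r * b < choose2 (length L) →
  ∃[ i ] b < agreeingPairs i L
richPart {r} {b} L int lt with any? (λ i → b <? agreeingPairs i L)
... | yes rich = rich
... | no ¬rich = contradiction
  (<-≤-trans lt (≤-trans (choose2≤∑agreeingPairs L int)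
    (sum-≤ _ (λ i → ≮⇒≥ (λ gt → ¬rich (i , gt))))))
  (<-irrefl refl)

-- Constructing covers

avoiding-intersecting : ∀ (i : Fin r) v {L} → Intersecting L → Intersecting (avoiding i v L)
avoiding-intersecting i v int a b = 
  int (proj₁ (∈-filter⁻ (misses? i v) a)) (proj₁ (∈-filter⁻ (misses? i v) b))

extendCover : ∀ (i : Fin r) v L → Coverable k (avoiding i v L) → Coverable (suc k) L
extendCover i v L (C , C≤k , cov) = (i , v) ∷ C , s≤s C≤k , cov′
  where
  cov′ : IsCover ((i , v) ∷ C) L
  cov′ {e} e∈L with lookup e i ≟ v
  ... | yes eq = here eq
  ... | no neq = there (cov (∈-filter⁺ (misses? i v) e∈L neq))

-- Two intersecting edges have a common vertex, so one vertex is spent on every two edges.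
pairsCoverable : ∀ k → AllCoverable r k (k + k)
pairsCoverable k       []      int _ = [] , z≤n , λ ()
-- Intersecting the lone edge with itself yields a part, so the edge has a vertex to choose.
pairsCoverable (suc k) (e ∷ []) int _ with i , _ ← int (here refl) (here refl) =
  (i , lookup e i) ∷ [] , s≤s z≤n , λ { (here refl) → here refl }
pairsCoverable (suc k) (e ∷ e′ ∷ L) int (s≤s le)
  with i , eq ← int (here refl) (there (here refl))
     | C , C≤k , cov ← pairsCoverable k L (λ a b → int (there (there a)) (there (there b)))
         (s≤s⁻¹ (≤-trans le (≤-reflexive (+-suc k k)))) =
  (i , lookup e i) ∷ C , s≤s C≤k ,
  λ { (here refl)         → here refl
    ; (there (here refl)) → here (sym eq)
    ; (there (there e∈))  → there (cov e∈) }

weaken : m ≤ n → AllCoverable r k n → AllCoverable r k m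
weaken m≤n cov L int L≤m = cov L int (≤-trans L≤m m≤n)

-- Repeating an edge does not change the covers, so the size can be assumed exact.
fromExact : (∀ (L : Hypergraph r) → Intersecting L → length L ≡ n → Coverable k L) →
  AllCoverable r k n
fromExact cov []      int _  = [] , z≤n , λ ()
fromExact {r} {n} {k} cov (e ∷ L) int le with g , eq ← m≤n⇒∃[o]m+o≡n le = pad g L int eq
  where
  merge : ∀ {e′ L} → e′ ∈ e ∷ e ∷ L → e′ ∈ e ∷ L
  merge (here eq)   = here eq
  merge (there e′∈) = e′∈

  pad : ∀ g (L : Hypergraph r) → Intersecting (e ∷ L) → suc (length L) + g ≡ n →
    Coverable k (e ∷ L)
  pad zero    L int eq = cov (e ∷ L) int (trans (sym (+-identityʳ _)) eq)
  pad (suc g) L int eq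
    with C , C≤k , cov′ ← pad g (e ∷ L) (λ a b → int (merge a) (merge b))
           (trans (sym (+-suc _ g)) eq) =
    C , C≤k , cov′ ∘ there

-- Lower bounds by removing heavy vertices of a single part

-- The induction stays in part `i`, so a lower bound on its agreeing pairs is carried along with the
-- number of edges.
PartCoverable : Fin r → (k n p : ℕ) → Set
PartCoverable {r} i k n p =
  ∀ (L : Hypergraph r) → Intersecting L → length L ≡ n → p ≤ agreeingPairs i L → Coverable k L

-- Take a vertex of degree ≥ 3 in part i: if its degree is exactly 3, only three
-- agreeing pairs of part i are lost, and otherwise at most n edges remain.
addTriple : ∀ {i : Fin r} → suc n + 3 < 2 * (p + 3) → AllCoverable r k n →
  PartCoverable i k (suc n) p → PartCoverable i (suc k) (suc n + 3) (p + 3)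
addTriple {r} {n} {p} {i = i} lt cov part L int len pairs
  -- With `d = 1`, more than half as many agreeing pairs as edges force a vertex of degree at least
  -- 3.
  with v , heavy ← heavyVertex {d = 1} i L (≤-trans
         (s≤s (≤-reflexive (trans (*-identityˡ _) len))) (≤-trans lt (*-monoʳ-≤ 2 pairs)))
  with m≤n⇒m<n∨m≡n heavy
... | inj₁ 3<deg = extendCover i v L (cov _ (avoiding-intersecting i v int) R≤n)
  where
  R≤n : length (avoiding i v L) ≤ n
  R≤n = +-cancelˡ-≤ 4 _ _ (≤-trans (+-monoˡ-≤ _ 3<deg)
    (≤-reflexive (trans (degree+avoiding i v L) (trans len (+-comm (suc n) 3)))))
... | inj₂ 3≡deg = extendCover i v L (part _ (avoiding-intersecting i v int) R≡ p≤R)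
  where
  R≡ : length (avoiding i v L) ≡ suc n
  R≡ = +-cancelˡ-≡ 3 _ _ (trans (cong (_+ length (avoiding i v L)) 3≡deg)
    (trans (degree+avoiding i v L) (trans len (+-comm (suc n) 3))))
  p≤R : p ≤ agreeingPairs i (avoiding i v L)
  p≤R = +-cancelˡ-≤ 3 _ _ (≤-trans (≤-reflexive (+-comm 3 p)) (≤-trans pairs
    (≤-reflexive (trans (agreeingPairs-split i v L)
      (cong (λ c → choose2 c + agreeingPairs i (avoiding i v L)) (sym 3≡deg))))))

fromParts : r * b < choose2 n → (∀ i → PartCoverable {r} i k n (suc b)) → AllCoverable r k n
fromParts lt part = fromExact λ L int len →
  let i , rich = richPart L int (subst (λ n → _ < choose2 n) (sym len) lt)
  in part i L int len rich

-- As 5 < 2 * 3, some vertex has degree at least 3, and the at most two remaining edges have a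
-- common vertex.
five : ∀ (i : Fin r) → PartCoverable i 2 5 3
five i = addTriple {p = 0} (≤ᵇ⇒≤ 6 6 tt) (weaken (n≤1+n 1) (pairsCoverable 1))
  (λ L int len _ → pairsCoverable 1 L int (≤-reflexive len))

-- Removing a vertex of degree 3 leaves five edges with at least three agreeing pairs, as in `five`;
-- a higher degree leaves at most two pairs of edges.
eight : ∀ (i : Fin r) → PartCoverable i 3 8 6
eight i = addTriple (≤ᵇ⇒≤ 9 12 tt) (pairsCoverable 2) (five i)

seven : ∀ (i : Fin r) → PartCoverable i 3 7 4
seven i = addTriple {p = 1} (≤ᵇ⇒≤ 8 8 tt) (weaken (n≤1+n 3) (pairsCoverable 2))
  (λ L int len _ → pairsCoverable 2 L int (≤-reflexive len))

fourPartite : AllCoverable 4 2 5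
-- Five edges form 10 > 4 * 2 pairs, so some part has at least three agreeing pairs.
fourPartite = fromParts {4} {2} {5} (≤ᵇ⇒≤ 9 10 tt) five

fivePartite : AllCoverable 5 3 8
fivePartite = fromParts {5} {5} {8} (≤ᵇ⇒≤ 26 28 tt) eight

sixPartite : AllCoverable 6 4 11
-- As 6 * 8 < 55, some part has at least nine agreeing pairs. A vertex of degree 3 leaves the
-- situation of `eight`. A higher degree leaves at most seven edges, for which a rich part is chosen
-- afresh, using 6 * 3 < 21.
sixPartite = fromParts {6} {8} {11} (≤ᵇ⇒≤ 49 55 tt) λ i →
  addTriple (≤ᵇ⇒≤ 12 18 tt) (fromParts {6} {3} {7} (≤ᵇ⇒≤ 19 21 tt) seven) (eight i)

fAtLeast : AllCoverable (2 + r) r n → FAtLeast (2 + r) (suc n)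
fAtLeast cov H (_ , int , τ) = ≰⇒> λ H≤n →
  let C , C≤r , isCover = cov H int H≤n
  in <-irrefl refl (≤-trans (τ C isCover) C≤r)

-- Upper bounds: deciding the cover number of explicit hypergraphs

-- This lets a chosen vertex be dropped from a cover once only edges avoiding it are left.
any-removeAt : ∀ {A : Set} {P Q : A → Set} {xs} (q : Any Q xs) →
  ¬ P (Data.List.lookup xs (index q)) → Any P xs → Any P (removeAt xs (index q))
any-removeAt (here _)  ¬p (here px)  = contradiction px ¬p
any-removeAt (here _)  ¬p (there ps) = ps
any-removeAt (there q) ¬p (here px)  = here px
any-removeAt (there q) ¬p (there ps) = there (any-removeAt q ¬p ps)

-- A cover must contain a vertex (i , lookup e i) of the first edge e.
branchCover : ∀ {e : Edge r} {H} → Coverable (suc k) (e ∷ H) →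
  ∃[ i ] Coverable k (avoiding i (lookup e i) (e ∷ H))
branchCover {r} {k} {e} {H} (C , C≤ , cov) =
  i , removeAt C j , ≤-trans (≤-reflexive (length-removeAt C j)) (∸-monoˡ-≤ 1 C≤) , cov′
  where
  q = cov (here refl)
  j = index q
  i = proj₁ (Data.List.lookup C j)
  cov′ : IsCover (removeAt C j) (avoiding i (lookup e i) (e ∷ H))
  cov′ e′∈ with e′∈H , ¬eq ← ∈-filter⁻ (misses? i (lookup e i)) e′∈ =
    any-removeAt q (λ eq → ¬eq (trans eq (sym (lookup-index q)))) (cov e′∈H)

-- Vertices range over an infinite set, but some vertex of the first edge must be chosen, so the
-- search branches `r` ways to depth at most `k`.
coverable? : ∀ k (H : Hypergraph r) → Dec (Coverable k H)
coverable? k       []      = yes ([] , z≤n , λ ())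
coverable? zero    (e ∷ H) = no λ { ([] , _ , cov) → contradiction (cov (here refl)) λ () }
coverable? (suc k) (e ∷ H) = map′ (λ (i , c) → extendCover i _ (e ∷ H) c) branchCover
  (any? λ i → coverable? k (avoiding i (lookup e i) (e ∷ H)))

intersecting? : (H : Hypergraph r) → Dec (Intersecting H)
intersecting? H = map′
  (λ all e∈H e′∈H → All.lookup (All.lookup all e∈H) e′∈H)
  (λ int → All.tabulate λ e∈H → All.tabulate λ e′∈H → int e∈H e′∈H)
  (All.all? (λ e → All.all? (λ e′ → any? λ i → lookup e i ≟ lookup e′ i) H) H)

-- The decision procedures are evaluated during type checking, so for a concrete hypergraph every
-- condition is proved by `tt`.
admissible : ∀ (H : Hypergraph (2 + r)) → True (DecUnique.unique? (≡-dec _≟_) H) →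
  True (intersecting? H) → False (coverable? r H) → Admissible (2 + r) H
admissible H simple int τ = toWitness simple , toWitness int ,
  λ C cov → ≰⇒> λ C≤r → toWitnessFalse τ (C , C≤r , cov)

-- The line y = m x + b is encoded by its values at all x, followed by its slope m;
-- in GF(4) = {0, 1, ω, ω²}, ω and ω² are written 2 and 3.

lines₃ : Hypergraph 4
lines₃ =
  (0 ∷ 0 ∷ 0 ∷ 0 ∷ []) ∷
  (1 ∷ 1 ∷ 1 ∷ 0 ∷ []) ∷
  (2 ∷ 2 ∷ 2 ∷ 0 ∷ []) ∷
  (0 ∷ 1 ∷ 2 ∷ 1 ∷ []) ∷
  (1 ∷ 2 ∷ 0 ∷ 1 ∷ []) ∷
  (2 ∷ 1 ∷ 0 ∷ 2 ∷ []) ∷ []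

lines₄ : Hypergraph 5
lines₄ =
  (0 ∷ 0 ∷ 0 ∷ 0 ∷ 0 ∷ []) ∷
  (3 ∷ 3 ∷ 3 ∷ 3 ∷ 0 ∷ []) ∷
  (2 ∷ 3 ∷ 0 ∷ 1 ∷ 1 ∷ []) ∷
  (0 ∷ 2 ∷ 3 ∷ 1 ∷ 2 ∷ []) ∷
  (2 ∷ 0 ∷ 1 ∷ 3 ∷ 2 ∷ []) ∷
  (0 ∷ 3 ∷ 1 ∷ 2 ∷ 3 ∷ []) ∷
  (1 ∷ 2 ∷ 0 ∷ 3 ∷ 3 ∷ []) ∷
  (2 ∷ 1 ∷ 3 ∷ 0 ∷ 3 ∷ []) ∷
  (3 ∷ 0 ∷ 2 ∷ 1 ∷ 3 ∷ []) ∷ []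

lines₅ : Hypergraph 6
lines₅ =
  (0 ∷ 0 ∷ 0 ∷ 0 ∷ 0 ∷ 0 ∷ []) ∷
  (3 ∷ 3 ∷ 3 ∷ 3 ∷ 3 ∷ 0 ∷ []) ∷
  (0 ∷ 1 ∷ 2 ∷ 3 ∷ 4 ∷ 1 ∷ []) ∷
  (4 ∷ 0 ∷ 1 ∷ 2 ∷ 3 ∷ 1 ∷ []) ∷
  (0 ∷ 2 ∷ 4 ∷ 1 ∷ 3 ∷ 2 ∷ []) ∷
  (1 ∷ 3 ∷ 0 ∷ 2 ∷ 4 ∷ 2 ∷ []) ∷
  (2 ∷ 4 ∷ 1 ∷ 3 ∷ 0 ∷ 2 ∷ []) ∷
  (4 ∷ 1 ∷ 3 ∷ 0 ∷ 2 ∷ 2 ∷ []) ∷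
  (0 ∷ 3 ∷ 1 ∷ 4 ∷ 2 ∷ 3 ∷ []) ∷
  (1 ∷ 4 ∷ 2 ∷ 0 ∷ 3 ∷ 3 ∷ []) ∷
  (2 ∷ 0 ∷ 3 ∷ 1 ∷ 4 ∷ 3 ∷ []) ∷
  (4 ∷ 2 ∷ 0 ∷ 3 ∷ 1 ∷ 3 ∷ []) ∷
  (4 ∷ 3 ∷ 2 ∷ 1 ∷ 0 ∷ 4 ∷ []) ∷ []

theorem1p4 : IsF 4 6 × IsF 5 9 × FAtLeast 6 12 × FAtMost 6 15
theorem1p4 =
  -- Parallel lines agree in the slope coordinate and other lines at their crossing point, which is
  -- why these hypergraphs are intersecting.
  ((lines₃ , admissible lines₃ tt tt tt , refl) , fAtLeast fourPartite) ,
  ((lines₄ , admissible lines₄ tt tt tt , refl) , fAtLeast fivePartite) ,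
  fAtLeast sixPartite ,
  -- Thirteen lines already suffice here, fewer than the 15 allowed.
  lines₅ , admissible lines₅ tt tt tt , ≤ᵇ⇒≤ 13 15 tt
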